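{- Let $\ell$ be a prime number, let $X$ be a connected finite multigraph and let $\mathfrak{T}\subseteq E_X$ be a fixed spanning tree of $X$. Let $\pi:E_X^+\to E_X$ be the natural quotient map from directed to undirected edges, let $S=\gamma(E_X)$ be the image of a section $\gamma:E_X\to E_X^+$ of $\pi$, and let $S(\mathfrak{T})=\{s\in S:\pi(s)\in\mathfrak{T}\}$. Let $\alpha:S\to\mathbb{Z}_\ell$ be a function satisfying $\alpha(s)=0$ for all $s\in S(\mathfrak{T})$. Then the derived multigraph $X(\mathbb{Z}/\ell^n\mathbb{Z},S,\alpha_{/n})$ is connected for all positive integers $n$ if and only if there exists $s\in S\smallsetminus S(\mathfrak{T})$ such that $\alpha(s)\in\mathbb{Z}_\ell^\times$.
   Context: A finite multigraph $X$ consists of a finite set of vertices $V_X$, a finite set of directed edges $E_X^+$, an incidence function $i:E_X^+\to V_X\times V_X$, $i(e)=(o(e),t(e))$ (origin and target), and an inversion function $\iota:E_X^+\to E_X^+$, $\iota(e)=\bar e$, such that $\iota^2=\mathrm{id}$, $\iota(e)\ne e$ and $i(\bar e)=(t(e),o(e))$ for all $e$. Loops and multiple edges are allowed. The set of undirected edges is $E_X=E_X^+/\iota$, and $\pi:E_X^+\to E_X$ is the $2:1$ quotient map. Connectedness and spanning trees have their usual meaning (a spanning tree is identified with its set of undirected edges). Derived multigraph: let $G$ be a finite abelian group (written additively) and $\beta:S\to G$ a function, extended to $E_X^+$ by $\beta(\bar s)=-\beta(s)$ for $s\in S$. The multigraph $X(G,S,\beta)$ has vertex set $V_X\times G$ and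 directed edge set $E_X^+\times G$; the directed edge $(e,\sigma)$ goes from $(o(e),\sigma)$ to $(t(e),\sigma+\beta(e))$, and its inverse is $\overline{(e,\sigma)}=(\bar e,\sigma+\beta(e))$. For $\alpha:S\to\mathbb{Z}_\ell$, $\alpha_{/n}:S\to\mathbb{Z}/\ell^n\mathbb{Z}$ denotes the reduction of $\alpha$ modulo $\ell^n$. -}

module Defs where

open import Algebra.Bundles using (AbelianGroup)
open import Algebra.Structures using (IsAbelianGroup)
import Algebra.Definitions
import Algebra.Properties.AbelianGroup as AbelianGroupProperties
open import Data.Fin.Base using (Fin; toℕ)
open import Data.Fin.Properties using (toℕ-fromℕ<; toℕ-injective; toℕ<n; *↔×)
  renaming (_≟_ to _≟ᶠ_)
open import Data.Irrelevant using ([_])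
open import Data.List.Base using (List; []; _∷_; map)
open import Data.List.Relation.Unary.All using (All)
open import Data.List.Relation.Unary.Unique.Propositional using () renaming (Unique to Unique≡)
import Data.List.Relation.Unary.Unique.Setoid as UniqueSetoid
open import Data.Nat.Base using (ℕ; suc; _+_; _*_; _^_; _∸_; _%_; NonZero)
open import Data.Nat.DivMod using (_mod_; %-distribˡ-+; %-distribˡ-*; m%n%n≡m%n; [m+n]%n≡m%n; m<n⇒m%n≡m; m∣n⇒o%n%m≡o%m)
open import Data.Nat.Divisibility using (n∣m*n)
open import Data.Nat.Primality using (Prime; prime⇒nonZero)
open import Data.Nat.Properties using (+-comm; +-assoc; m+[n∸m]≡n; <⇒≤; m^n≢0)
open import Data.Product.Base using (Σ; ∃; ∃-syntax; Σ-syntax; _×_; _,_; proj₁; proj₂; swap)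
open import Data.Product.Function.NonDependent.Propositional using (_×-↔_)
open import Data.Refinement as Refinement using (Refinement-syntax; value)
open import Data.Sum.Base using (_⊎_; inj₁; inj₂)
open import Function.Base using (_∘_; id)
open import Function.Bundles using (_↔_; Func)
open import Function.Definitions using (StrictlyInverseˡ)
open import Function.Properties.Inverse using (↔-refl; ↔-sym; ↔-trans; ↔⇒↣)
open import Level using (0ℓ)
open import Relation.Binary.Bundles using (Setoid)
open import Relation.Binary.Construct.Closure.ReflexiveTransitive using (Star; ε; _◅_)
open import Relation.Binary.Definitions using (DecidableEquality; _Respects_)
open import Relation.Binary.PropositionalEquality
open import Relation.Binary.PropositionalEquality.Algebra using (isMagma)
open import Relation.Nullary.Decidable using (yes; no; via-injection)
open import Relation.Nullary.Negation using (¬_; contradiction)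
open import Relation.Unary using (Pred; _∈_)

Finite : Set → Set
Finite A = ∃[ n ] A ↔ Fin n

Finite-× : ∀ {A B} → Finite A → Finite B → Finite (A × B)
Finite-× (m , f) (n , g) = m * n , ↔-trans (f ×-↔ g) (↔-sym *↔×)

Finite⇒≟ : ∀ {A} → Finite A → DecidableEquality A
Finite⇒≟ (_ , f) = via-injection (↔⇒↣ f) _≟ᶠ_

record Multigraph : Set₁ where
  field
    V        : Set
    E⁺       : Set
    V-finite : Finite V
    E-finite : Finite E⁺
    i        : E⁺ → V × V
    inv      : E⁺ → E⁺
    inv-invol : ∀ e → inv (inv e) ≡ e
    inv-≢     : ∀ e → inv e ≢ e
    i-inv     : ∀ e → i (inv e) ≡ swap (i e)

  o t : E⁺ → V
  o = proj₁ ∘ i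
  t = proj₂ ∘ i

  _≟ᴱ_ : DecidableEquality E⁺
  _≟ᴱ_ = Finite⇒≟ E-finite

  infix 4 _~_
  _~_ : E⁺ → E⁺ → Set
  e ~ e′ = e ≡ e′ ⊎ inv e ≡ e′

  -- The quotient E⁺/ι is the setoid on E⁺ whose equality is lying in the
  -- same ι-orbit, so π is the identity on underlying elements.
  E : Setoid 0ℓ 0ℓ
  E = record
    { Carrier       = E⁺
    ; _≈_           = _~_
    ; isEquivalence = record { refl = inj₁ refl ; sym = ~-sym ; trans = ~-trans }
    }
    where
    ~-sym : ∀ {e f} → e ~ f → f ~ e
    ~-sym (inj₁ p)    = inj₁ (sym p)
    ~-sym (inj₂ refl) = inj₂ (inv-invol _)

    ~-trans : ∀ {e f g} → e ~ f → f ~ g → e ~ g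
    ~-trans (inj₁ refl) q           = q
    ~-trans (inj₂ p)    (inj₁ refl) = inj₂ p
    ~-trans (inj₂ refl) (inj₂ refl) = inj₁ (sym (inv-invol _))

  π : Func (setoid E⁺) E
  π = record { to = id ; cong = inj₁ }

  Link : V → V → Set
  Link u v = ∃[ e ] i e ≡ (u , v)

  Walk : V → V → Set
  Walk = Star Link

  edges : ∀ {u v} → Walk u v → List E⁺
  edges ε             = []
  edges ((e , _) ◅ w) = e ∷ edges w

  -- A cycle of length 1 is a loop and one of length 2 is a pair of parallel
  -- edges; going along an edge and straight back is excluded by the last clause.
  IsCycle : ∀ {u} → Walk u u → Set
  IsCycle w = edges w ≢ []
            × Unique≡ (map o (edges w))
            × UniqueSetoid.Unique E (map (Func.to π) (edges w))

-- The empty multigraph is not connected.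
Connected : Multigraph → Set
Connected X = V × (∀ u v → Walk u v)
  where open Multigraph X

-- 𝔗 is a set of undirected edges: a predicate on E⁺ constant on ι-orbits.
record IsSpanningTree (X : Multigraph) (𝔗 : Pred (Setoid.Carrier (Multigraph.E X)) 0ℓ) : Set where
  open Multigraph X
  field
    respects  : 𝔗 Respects _~_
    connected : V × (∀ u v → Σ[ w ∈ Walk u v ] All (𝔗 ∘ Func.to π) (edges w))
    acyclic   : ∀ {u} (w : Walk u u) → All (𝔗 ∘ Func.to π) (edges w) → ¬ IsCycle w

record SectionOf-π (X : Multigraph) : Set where
  open Multigraph X
  field
    γ       : Func E (setoid E⁺)
    section : StrictlyInverseˡ _~_ (Func.to π) (Func.to γ)

-- The image of γ; membership proofs are irrelevant, so this is a genuine
-- subset of E⁺ (an element is determined by its value).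
Image : (X : Multigraph) → SectionOf-π X → Set
Image X sec = [ s ∈ E⁺ ∣ (∃[ e ] Func.to γ e ≡ s) ]
  where open Multigraph X; open SectionOf-π sec

-- S(𝔗), as a subset of S = Image X sec.
ImageOver : ∀ X sec → Pred (Setoid.Carrier (Multigraph.E X)) 0ℓ → Pred (Image X sec) 0ℓ
ImageOver X sec 𝔗 s = Func.to (Multigraph.π X) (value s) ∈ 𝔗

record FiniteAbelianGroup : Set₁ where
  infixl 6 _⊕_
  infix  8 ⊖_
  field
    Carrier : Set
    _⊕_     : Carrier → Carrier → Carrier
    𝟘       : Carrier
    ⊖_      : Carrier → Carrier
    isAbelianGroup : IsAbelianGroup _≡_ _⊕_ 𝟘 ⊖_
    finite         : Finite Carrier

  abelianGroup : AbelianGroup 0ℓ 0ℓ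
  abelianGroup = record { isAbelianGroup = isAbelianGroup }

  open IsAbelianGroup isAbelianGroup public using (assoc; identityʳ; inverseʳ)
  open AbelianGroupProperties abelianGroup public using (⁻¹-involutive)

module _ (X : Multigraph) (sec : SectionOf-π X) (G : FiniteAbelianGroup) where
  open Multigraph X
  open SectionOf-π sec
  open FiniteAbelianGroup G

  representative : E⁺ → Image X sec
  representative e = Refinement._,_ (Func.to γ e) [ e , refl ]

  -- Exactly one of e and ē lies in S, namely γ (π e).
  extend : (Image X sec → Carrier) → E⁺ → Carrier
  extend β e with Func.to γ e ≟ᴱ e
  ... | yes _ = β (representative e)
  ... | no  _ = ⊖ β (representative e)

  private
    γ-inv : ∀ e → Func.to γ (inv e) ≡ Func.to γ e
    γ-inv e = Func.cong γ (inj₂ (inv-invol e))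

    representative-inv : ∀ e → representative (inv e) ≡ representative e
    representative-inv e = Refinement.value-injective (γ-inv e)

  extend-inv : ∀ β e → extend β (inv e) ≡ ⊖ extend β e
  extend-inv β e with Func.to γ (inv e) ≟ᴱ inv e | Func.to γ e ≟ᴱ e
  ... | yes p | yes q = contradiction (trans (sym p) (trans (γ-inv e) q)) (inv-≢ e)
  ... | yes p | no  q = trans (cong β (representative-inv e)) (sym (⁻¹-involutive _))
  ... | no  p | yes q = cong (⊖_ ∘ β) (representative-inv e)
  ... | no  p | no  q with section e
  ...   | inj₁ r = contradiction r q
  ...   | inj₂ r = contradiction (trans (γ-inv e) (trans (sym (inv-invol _)) (cong inv r))) p

  derived : (Image X sec → Carrier) → Multigraph
  derived β = record
    { V         = V × Carrier
    ; E⁺        = E⁺ × Carrier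
    ; V-finite  = Finite-× V-finite finite
    ; E-finite  = Finite-× E-finite finite
    ; i         = λ (e , σ) → (o e , σ) , (t e , σ ⊕ extend β e)
    ; inv       = λ (e , σ) → inv e , σ ⊕ extend β e
    ; inv-invol = λ (e , σ) → cong₂ _,_ (inv-invol e) (cancel e σ)
    ; inv-≢     = λ (e , σ) p → inv-≢ e (cong proj₁ p)
    ; i-inv     = λ (e , σ) → cong₂ _,_
                    (cong (_, σ ⊕ extend β e) (cong proj₁ (i-inv e)))
                    (cong₂ _,_ (cong proj₂ (i-inv e)) (cancel e σ))
    }
    where
    cancel : ∀ e σ → σ ⊕ extend β e ⊕ extend β (inv e) ≡ σ
    cancel e σ = begin
      σ ⊕ extend β e ⊕ extend β (inv e)   ≡⟨ assoc _ _ _ ⟩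
      σ ⊕ (extend β e ⊕ extend β (inv e)) ≡⟨ cong (λ x → σ ⊕ (extend β e ⊕ x)) (extend-inv β e) ⟩
      σ ⊕ (extend β e ⊕ ⊖ extend β e)     ≡⟨ cong (σ ⊕_) (inverseʳ _) ⟩
      σ ⊕ 𝟘                               ≡⟨ identityʳ σ ⟩
      σ                                   ∎
      where open ≡-Reasoning

-- Elements of ℤ/m are represented by their least residues.

module _ (m : ℕ) .{{_ : NonZero m}} where
  addMod : Fin m → Fin m → Fin m
  addMod a b = (toℕ a + toℕ b) mod m

  negMod : Fin m → Fin m
  negMod a = (m ∸ toℕ a) mod m

module _ {m : ℕ} .{{_ : NonZero m}} where
  toℕ-mod : ∀ k → toℕ (k mod m) ≡ k % m
  toℕ-mod k = toℕ-fromℕ< _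

  mod-cong : ∀ {j k} → j % m ≡ k % m → j mod m ≡ k mod m
  mod-cong {j} {k} p = toℕ-injective (trans (toℕ-mod j) (trans p (sym (toℕ-mod k))))

  toℕ-mod-id : (a : Fin m) → toℕ a mod m ≡ a
  toℕ-mod-id a = toℕ-injective (trans (toℕ-mod (toℕ a)) (m<n⇒m%n≡m (toℕ<n a)))

  private
    %-+ˡ : ∀ j k → (j % m + k) % m ≡ (j + k) % m
    %-+ˡ j k = begin
      (j % m + k) % m         ≡⟨ %-distribˡ-+ (j % m) k m ⟩
      (j % m % m + k % m) % m ≡⟨ cong (λ x → (x + k % m) % m) (m%n%n≡m%n j m) ⟩
      (j % m + k % m) % m     ≡⟨ %-distribˡ-+ j k m ⟨
      (j + k) % m             ∎
      where open ≡-Reasoning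

    addMod-comm : ∀ a b → addMod m a b ≡ addMod m b a
    addMod-comm a b = cong (_mod m) (+-comm (toℕ a) (toℕ b))

    addMod-mod : ∀ j (c : Fin m) → addMod m (j mod m) c ≡ (j + toℕ c) mod m
    addMod-mod j c = mod-cong (trans (cong (λ x → (x + toℕ c) % m) (toℕ-mod j)) (%-+ˡ j (toℕ c)))

    addMod-assoc : ∀ a b c → addMod m (addMod m a b) c ≡ addMod m a (addMod m b c)
    addMod-assoc a b c = begin
      addMod m (addMod m a b) c           ≡⟨ addMod-mod _ c ⟩
      (toℕ a + toℕ b + toℕ c) mod m       ≡⟨ cong (_mod m) (trans (+-assoc (toℕ a) _ _) (+-comm (toℕ a) _)) ⟩
      ((toℕ b + toℕ c) + toℕ a) mod m     ≡⟨ addMod-mod _ a ⟨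
      addMod m (addMod m b c) a           ≡⟨ addMod-comm _ a ⟩
      addMod m a (addMod m b c)           ∎
      where open ≡-Reasoning

    addMod-identityˡ : ∀ a → addMod m (0 mod m) a ≡ a
    addMod-identityˡ a = trans (addMod-mod 0 a) (toℕ-mod-id a)

    addMod-inverseˡ : ∀ a → addMod m (negMod m a) a ≡ 0 mod m
    addMod-inverseˡ a = begin
      addMod m (negMod m a) a       ≡⟨ addMod-mod _ a ⟩
      (m ∸ toℕ a + toℕ a) mod m     ≡⟨ cong (_mod m) (trans (+-comm _ (toℕ a)) (m+[n∸m]≡n (<⇒≤ (toℕ<n a)))) ⟩
      m mod m                       ≡⟨ mod-cong ([m+n]%n≡m%n 0 m) ⟩
      0 mod m                       ∎
      where open ≡-Reasoning

  addMod-isAbelianGroup : IsAbelianGroup _≡_ (addMod m) (0 mod m) (negMod m)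
  addMod-isAbelianGroup = record
    { isGroup = record
      { isMonoid = record
        { isSemigroup = record
          { isMagma = isMagma (addMod m)
          ; assoc   = addMod-assoc
          }
        ; identity = addMod-identityˡ , λ a → trans (addMod-comm a _) (addMod-identityˡ a)
        }
      ; inverse = addMod-inverseˡ , λ a → trans (addMod-comm a _) (addMod-inverseˡ a)
      ; ⁻¹-cong = cong (negMod m)
      }
    ; comm = addMod-comm
    }

ℤ/ : (m : ℕ) .{{_ : NonZero m}} → FiniteAbelianGroup
ℤ/ m = record
  { Carrier        = Fin m
  ; _⊕_            = addMod m
  ; 𝟘              = 0 mod m
  ; ⊖_             = negMod m
  ; isAbelianGroup = addMod-isAbelianGroup
  ; finite         = m , ↔-refl
  }

-- ℤ_ℓ is the inverse limit of the rings ℤ/ℓⁿ: coherent sequences of residues,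
-- compared termwise.

module _ {ℓ : ℕ} (pr : Prime ℓ) where
  private
    ℓ^n≢0 : ∀ n → NonZero (ℓ ^ n)
    ℓ^n≢0 n = m^n≢0 ℓ n {{prime⇒nonZero pr}}

  ℤ/ℓ^ : ℕ → FiniteAbelianGroup
  ℤ/ℓ^ n = ℤ/ (ℓ ^ n) {{ℓ^n≢0 n}}

  infixl 7 _modℓ^_
  _modℓ^_ : ℕ → ∀ n → Fin (ℓ ^ n)
  k modℓ^ n = _mod_ k (ℓ ^ n) {{ℓ^n≢0 n}}

  record ℤ-adic : Set where
    field
      residue  : ∀ n → Fin (ℓ ^ n)
      coherent : ∀ n → toℕ (residue (suc n)) modℓ^ n ≡ residue n
  open ℤ-adic

  infix 4 _≈ₐ_
  _≈ₐ_ : ℤ-adic → ℤ-adic → Set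
  x ≈ₐ y = ∀ n → residue x n ≡ residue y n

  private
    mod-coherent : ∀ k n → toℕ (k modℓ^ suc n) modℓ^ n ≡ k modℓ^ n
    mod-coherent k n = mod-cong (trans (cong (_% (ℓ ^ n)) (toℕ-mod k))
                                       (m∣n⇒o%n%m≡o%m (ℓ ^ n) (ℓ ^ suc n) k (n∣m*n ℓ)))
      where instance
        _ = ℓ^n≢0 n
        _ = ℓ^n≢0 (suc n)

  fromℕₐ : ℕ → ℤ-adic
  fromℕₐ k = record { residue = k modℓ^_ ; coherent = mod-coherent k }

  0ₐ 1ₐ : ℤ-adic
  0ₐ = fromℕₐ 0
  1ₐ = fromℕₐ 1

  infixl 7 _*ₐ_
  _*ₐ_ : ℤ-adic → ℤ-adic → ℤ-adic
  x *ₐ y = record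
    { residue  = λ n → (toℕ (residue x n) * toℕ (residue y n)) modℓ^ n
    ; coherent = λ n → trans (mod-coherent _ n) (*-coherent n)
    }
    where
    *-coherent : ∀ n → (toℕ (residue x (suc n)) * toℕ (residue y (suc n))) modℓ^ n
                     ≡ (toℕ (residue x n) * toℕ (residue y n)) modℓ^ n
    *-coherent n = trans
      (mod-cong (%-distribˡ-* a b (ℓ ^ n)))
      (cong₂ (λ j k → (j * k) modℓ^ n) (residue-% x) (residue-% y))
      where
      instance _ = ℓ^n≢0 n
      a = toℕ (residue x (suc n))
      b = toℕ (residue y (suc n))
      residue-% : ∀ z → toℕ (residue z (suc n)) % (ℓ ^ n) ≡ toℕ (residue z n)
      residue-% z = trans (sym (toℕ-mod _)) (cong toℕ (coherent z n))

  IsUnit : ℤ-adic → Set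
  IsUnit = Algebra.Definitions.Invertible _≈ₐ_ 1ₐ _*ₐ_

  -- α_{/n}, the reduction of α modulo ℓⁿ.
  reduce : ∀ {S : Set} → (S → ℤ-adic) → ∀ n → S → FiniteAbelianGroup.Carrier (ℤ/ℓ^ n)
  reduce α n s = residue (α s) n

{-# OPTIONS --safe #-}

-- Along tree edges the voltage vanishes, so tree walks lift to every sheet with
-- the ℤ/ℓⁿ-coordinate unchanged. If all voltages vanish modulo ℓ, no walk at
-- level 1 changes its coordinate, so connectedness at n = 1 yields s with α(s)
-- nonzero modulo ℓ, and such an ℓ-adic integer is a unit by Bézout. Conversely
-- a unit voltage α(s) generates ℤ/ℓⁿ, and traversing s repeatedly, returning
-- inside the tree, reaches every coordinate.

module Submission where

open import Defs
open import Algebra.Bundles using (AbelianGroup)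
open import Algebra.Properties.Group using (ε⁻¹≈ε)
open import Data.Fin.Base using (Fin; toℕ)
open import Data.Fin.Properties using (toℕ<n)
open import Data.Irrelevant using ([_])
open import Data.List.Relation.Unary.All as All using (All; []; _∷_)
open import Data.Nat.Base
  using (ℕ; zero; suc; _+_; _*_; _∸_; _^_; _%_; _<_; z<s; NonZero; nonTrivial⇒n>1)
open import Data.Nat.Coprimality using (Coprime; coprime-Bézout; coprime-divisor)
open import Data.Nat.Divisibility
open import Data.Nat.DivMod
open import Data.Nat.GCD using (module Bézout)
open import Data.Nat.Primality using (Prime; prime⇒nonZero; prime⇒nonTrivial; prime⇒irreducible)
open import Data.Nat.Properties
open import Data.Nat.Tactic.RingSolver using (solve-∀)
open import Data.Product.Base using (∃-syntax; _×_; _,_; proj₁; proj₂)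
open import Data.Refinement as Refinement using (value)
open import Data.Sum.Base using (_⊎_; inj₁; inj₂)
open import Function.Bundles using (_⇔_; mk⇔; Func)
open import Level using (0ℓ)
open import Relation.Binary.Bundles using (Setoid)
open import Relation.Binary.Construct.Closure.ReflexiveTransitive using (ε; _◅_; _◅◅_)
open import Relation.Binary.PropositionalEquality
open import Relation.Nullary.Decidable using (yes; no; recompute)
open import Relation.Nullary.Negation using (contradiction)
open import Relation.Unary using (Pred; _∈_; _∉_)

-- Inverses and generators in ℤ/m, computed on natural representatives.

module _ (m : ℕ) .{{_ : NonZero m}} where

  %-cong-+ : ∀ {i j k l} → i % m ≡ j % m → k % m ≡ l % m → (i + k) % m ≡ (j + l) % m
  %-cong-+ {i} {j} {k} {l} p q = begin
    (i + k) % m         ≡⟨ %-distribˡ-+ i k m ⟩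
    (i % m + k % m) % m ≡⟨ cong₂ (λ x y → (x + y) % m) p q ⟩
    (j % m + l % m) % m ≡⟨ %-distribˡ-+ j l m ⟨
    (j + l) % m         ∎
    where open ≡-Reasoning

  %-cong-* : ∀ {i j k l} → i % m ≡ j % m → k % m ≡ l % m → (i * k) % m ≡ (j * l) % m
  %-cong-* {i} {j} {k} {l} p q = begin
    (i * k) % m             ≡⟨ %-distribˡ-* i k m ⟩
    ((i % m) * (k % m)) % m ≡⟨ cong₂ (λ x y → (x * y) % m) p q ⟩
    ((j % m) * (l % m)) % m ≡⟨ %-distribˡ-* j l m ⟨
    (j * l) % m             ∎
    where open ≡-Reasoning

  coprime⇒invertible : ∀ {a} → Coprime a m → ∃[ b ] (b * a) % m ≡ 1 % m
  coprime⇒invertible {a} c with coprime-Bézout c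
  ... | Bézout.+- x y eq = x , trans (cong (_% m) (sym eq)) ([m+kn]%n≡m%n 1 y m)
  -- Here x a ≡ −1, so (x a)² ≡ 1.
  ... | Bézout.-+ x y eq = (x * a) * x , (begin
    (x * a * x * a) % m               ≡⟨ [m+kn]%n≡m%n _ y m ⟨
    (x * a * x * a + y * m) % m       ≡⟨ cong (λ z → (x * a * x * a + z) % m) eq ⟨
    (x * a * x * a + (1 + x * a)) % m ≡⟨ cong (_% m) (factor x a) ⟩
    (1 + x * a * (1 + x * a)) % m     ≡⟨ cong (λ z → (1 + x * a * z) % m) eq ⟩
    (1 + x * a * (y * m)) % m         ≡⟨ cong (λ z → (1 + z) % m) (*-assoc (x * a) y m) ⟨
    (1 + x * a * y * m) % m           ≡⟨ [m+kn]%n≡m%n 1 (x * a * y) m ⟩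
    1 % m                             ∎)
    where
    open ≡-Reasoning
    factor : ∀ x a → x * a * x * a + (1 + x * a) ≡ 1 + x * a * (1 + x * a)
    factor = solve-∀

  -- Evaluate the product of `a`, `b` and `c` in two ways. This is what makes inverses chosen
  -- separately modulo each power of ℓ fit together.
  inverse-unique : ∀ {a b c} → (b * a) % m ≡ 1 % m → (c * a) % m ≡ 1 % m → b % m ≡ c % m
  inverse-unique {a} {b} {c} p q = begin
    b % m             ≡⟨ cong (_% m) (*-identityʳ b) ⟨
    (b * 1) % m       ≡⟨ %-cong-* {b} {b} {c * a} {1} refl q ⟨
    (b * (c * a)) % m ≡⟨ cong (_% m) (swap-outer b c a) ⟩
    (c * (b * a)) % m ≡⟨ %-cong-* {c} {c} {b * a} {1} refl p ⟩
    (c * 1) % m       ≡⟨ cong (_% m) (*-identityʳ c) ⟩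
    c % m             ∎
    where
    open ≡-Reasoning
    swap-outer : ∀ b c a → b * (c * a) ≡ c * (b * a)
    swap-outer = solve-∀

  invertible⇒generates : ∀ {a b} → (b * a) % m ≡ 1 % m →
                         ∀ (σ τ : Fin m) → ∃[ k ] (toℕ σ + k * a) % m ≡ toℕ τ % m
  invertible⇒generates {a} {b} p σ τ = d * b , (begin
    (toℕ σ + d * b * a) % m             ≡⟨ cong (λ z → (toℕ σ + z) % m) (*-assoc d b a) ⟩
    (toℕ σ + d * (b * a)) % m           ≡⟨ %-cong-+ {toℕ σ} refl (%-cong-* {d} {d} {b * a} {1} refl p) ⟩
    (toℕ σ + d * 1) % m                 ≡⟨ cong (_% m) (regroup (toℕ σ) (toℕ τ) (m ∸ toℕ σ)) ⟩
    (toℕ τ + (toℕ σ + (m ∸ toℕ σ))) % m ≡⟨ cong (λ z → (toℕ τ + z) % m) (m+[n∸m]≡n (<⇒≤ (toℕ<n σ))) ⟩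
    (toℕ τ + m) % m                     ≡⟨ [m+n]%n≡m%n (toℕ τ) m ⟩
    toℕ τ % m                           ∎)
    where
    open ≡-Reasoning
    d : ℕ
    -- `d` represents τ - σ; since σ < m the truncated subtraction is exact. Multiplying by the
    -- inverse `b` of `a` gives the number of steps of size `a`.
    d = toℕ τ + (m ∸ toℕ σ)
    regroup : ∀ s t u → s + (t + u) * 1 ≡ t + (s + u)
    regroup = solve-∀

  addMod-mod-+ : ∀ j (c : Fin m) → addMod m (j mod m) c ≡ (j + toℕ c) mod m
  addMod-mod-+ j c = mod-cong
    (%-cong-+ {toℕ (j mod m)} {j} {toℕ c} (trans (cong (_% m) (toℕ-mod j)) (m%n%n≡m%n j m)) refl)

  ∣toℕ⇒≡0 : (a : Fin m) → m ∣ toℕ a → a ≡ 0 mod m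
  ∣toℕ⇒≡0 a m∣a = trans (sym (toℕ-mod-id a))
    (mod-cong (trans (n∣m⇒m%n≡0 (toℕ a) m m∣a) (sym (m*n%n≡0 0 m))))

  mod≡⇒%≡ : ∀ {j k} → j mod m ≡ k mod m → j % m ≡ k % m
  mod≡⇒%≡ {j} {k} p = trans (sym (toℕ-mod j)) (trans (cong toℕ p) (toℕ-mod k))

-- A common divisor of `a` and `m * n` is itself coprime to `m`, since its divisors divide `a`; so
-- by Euclid's lemma it divides `n`.
coprime-*ʳ : ∀ {a m n} → Coprime a m → Coprime a n → Coprime a (m * n)
coprime-*ʳ c d (i∣a , i∣mn) =
  d (i∣a , coprime-divisor (λ (j∣i , j∣m) → c (∣-trans j∣i i∣a , j∣m)) i∣mn)

coprime-^ʳ : ∀ {a m} n → Coprime a m → Coprime a (m ^ n)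
coprime-^ʳ zero    c (_ , i∣1) = ∣1⇒≡1 i∣1
coprime-^ʳ (suc n) c = coprime-*ʳ c (coprime-^ʳ n c)

prime∤⇒coprime : ∀ {p a} → Prime p → p ∤ a → Coprime a p
prime∤⇒coprime pr p∤a (i∣a , i∣p) with prime⇒irreducible pr i∣p
... | inj₁ i≡1  = i≡1
... | inj₂ refl = contradiction i∣a p∤a

-- Units among the ℓ-adic integers.

module _ {ℓ : ℕ} (pr : Prime ℓ) where

  open ℤ-adic

  ^-nonZero : ∀ n → NonZero (ℓ ^ n)
  ^-nonZero n = m^n≢0 ℓ n {{prime⇒nonZero pr}}

  1<ℓ¹ : 1 < ℓ ^ 1
  1<ℓ¹ = subst (1 <_) (sym (^-identityʳ ℓ)) (nonTrivial⇒n>1 ℓ {{prime⇒nonTrivial pr}})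

  -- The candidate `b` is a natural number rather than a residue, so that the same `b` can be tested
  -- at several levels.
  InverseAt : ℕ → ℤ-adic pr → ℕ → Set
  InverseAt n x b = (b * toℕ (residue x n)) % (ℓ ^ n) ≡ 1 % (ℓ ^ n)
    where instance _ = ^-nonZero n

  module _ (n : ℕ) where
    private instance
      ℓⁿ≢0 : NonZero (ℓ ^ n)
      ℓⁿ≢0 = ^-nonZero n

      ℓⁿ⁺¹≢0 : NonZero (ℓ ^ suc n)
      ℓⁿ⁺¹≢0 = ^-nonZero (suc n)

    residue-suc-% : ∀ (x : ℤ-adic pr) → toℕ (residue x (suc n)) % (ℓ ^ n) ≡ toℕ (residue x n)
    residue-suc-% x = trans (sym (toℕ-mod _)) (cong toℕ (coherent x n))

    ∣residue-suc⇒∣residue : ∀ (x : ℤ-adic pr) {d} → d ∣ ℓ ^ n →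
                            d ∣ toℕ (residue x (suc n)) → d ∣ toℕ (residue x n)
    ∣residue-suc⇒∣residue x d∣ℓⁿ p = subst (_ ∣_) (residue-suc-% x) (%-presˡ-∣ p d∣ℓⁿ)

    %-reduce : ∀ k → k % (ℓ ^ suc n) % (ℓ ^ n) ≡ k % (ℓ ^ n)
    %-reduce k = m∣n⇒o%n%m≡o%m (ℓ ^ n) (ℓ ^ suc n) k (n∣m*n ℓ)

    inverseAt-suc : ∀ x b → InverseAt (suc n) x b → InverseAt n x b
    inverseAt-suc x b inverse = begin
      (b * toℕ (residue x n)) % (ℓ ^ n) ≡⟨ cong (λ z → (b * z) % (ℓ ^ n)) (residue-suc-% x) ⟨
      (b * (a % (ℓ ^ n))) % (ℓ ^ n)     ≡⟨ %-cong-* (ℓ ^ n) {b} refl (m%n%n≡m%n a (ℓ ^ n)) ⟩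
      (b * a) % (ℓ ^ n)                 ≡⟨ %-reduce (b * a) ⟨
      (b * a) % (ℓ ^ suc n) % (ℓ ^ n)   ≡⟨ cong (_% (ℓ ^ n)) inverse ⟩
      1 % (ℓ ^ suc n) % (ℓ ^ n)         ≡⟨ %-reduce 1 ⟩
      1 % (ℓ ^ n)                       ∎
      where
      open ≡-Reasoning
      a : ℕ
      a = toℕ (residue x (suc n))

    -- Bézout yields `b` and `c` independently, but `b` still inverts `x` one level down, where
    -- inverses are unique.
    inverseAt-coherent : ∀ x {b c} → InverseAt (suc n) x b → InverseAt n x c →
                         toℕ (b mod (ℓ ^ suc n)) mod (ℓ ^ n) ≡ c mod (ℓ ^ n)
    inverseAt-coherent x {b} {c} p q = mod-cong (begin
      toℕ (b mod (ℓ ^ suc n)) % (ℓ ^ n) ≡⟨ cong (_% (ℓ ^ n)) (toℕ-mod b) ⟩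
      b % (ℓ ^ suc n) % (ℓ ^ n)         ≡⟨ %-reduce b ⟩
      b % (ℓ ^ n)                       ≡⟨ inverse-unique (ℓ ^ n) (inverseAt-suc x b p) q ⟩
      c % (ℓ ^ n)                       ∎)
      where open ≡-Reasoning

    inverseAt⇒mod-inverse : ∀ x {b} → InverseAt n x b →
      (toℕ (b mod (ℓ ^ n)) * toℕ (residue x n)) mod (ℓ ^ n) ≡ 1 mod (ℓ ^ n)
    inverseAt⇒mod-inverse x {b} p = mod-cong (trans
      (%-cong-* (ℓ ^ n) {k = toℕ (residue x n)}
        (trans (cong (_% (ℓ ^ n)) (toℕ-mod b)) (m%n%n≡m%n b (ℓ ^ n))) refl)
      p)

  -- Descend one level at a time: reducing modulo a positive power of ℓ preserves divisibility by ℓ.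
  -- Used contrapositively, to carry nonvanishing modulo ℓ up to all higher levels.
  ∣residue⇒∣residue₁ : ∀ (x : ℤ-adic pr) n → ℓ ∣ toℕ (residue x (suc n)) → ℓ ∣ toℕ (residue x 1)
  ∣residue⇒∣residue₁ x zero    p = p
  ∣residue⇒∣residue₁ x (suc n) p =
    ∣residue⇒∣residue₁ x n (∣residue-suc⇒∣residue (suc n) x (m∣m*n (ℓ ^ n)) p)

  private instance
    ℓ¹≢0 : NonZero (ℓ ^ 1)
    ℓ¹≢0 = ^-nonZero 1

  0%ℓ¹≡0 : 0 % (ℓ ^ 1) ≡ 0
  0%ℓ¹≡0 = m<n⇒m%n≡m (<-trans z<s 1<ℓ¹)

  0≢1-mod-ℓ¹ : residue (0ₐ pr) 1 ≢ residue (1ₐ pr) 1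
  0≢1-mod-ℓ¹ p = contradiction
    (trans (sym 0%ℓ¹≡0) (trans (mod≡⇒%≡ (ℓ ^ 1) p) (m<n⇒m%n≡m 1<ℓ¹))) λ ()

  -- Each residue of `x` is coprime to its modulus, hence invertible there, and the levelwise
  -- inverses form a coherent sequence `y`.
  residue₁≢0⇒isUnit : ∀ x → residue x 1 ≢ residue (0ₐ pr) 1 → IsUnit pr x
  residue₁≢0⇒isUnit x x≢0 = y , y*x≈1 , λ n →
    trans (cong (λ k → _modℓ^_ pr k n) (*-comm (toℕ (residue x n)) (toℕ (residue y n)))) (y*x≈1 n)
    where
    coprime : ∀ n → Coprime (toℕ (residue x n)) (ℓ ^ n)
    -- At level 0 the modulus is 1, so the residue carries no information; the descent to level 1
    -- applies only from positive levels.
    coprime zero    (_ , i∣1) = ∣1⇒≡1 i∣1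
    coprime (suc n) = coprime-^ʳ (suc n)
      (prime∤⇒coprime pr (λ p → x≢0 (∣toℕ⇒≡0 (ℓ ^ 1) (residue x 1)
        (subst (_∣ toℕ (residue x 1)) (sym (^-identityʳ ℓ)) (∣residue⇒∣residue₁ x n p)))))

    inverse : ∀ n → ∃[ b ] InverseAt n x b
    inverse n = coprime⇒invertible (ℓ ^ n) {{^-nonZero n}} (coprime n)

    y : ℤ-adic pr
    y .residue n  = _modℓ^_ pr (proj₁ (inverse n)) n
    y .coherent n = inverseAt-coherent n x (proj₂ (inverse (suc n))) (proj₂ (inverse n))

    y*x≈1 : _≈ₐ_ pr (_*ₐ_ pr y x) (1ₐ pr)
    y*x≈1 n = inverseAt⇒mod-inverse n x (proj₂ (inverse n))

-- Voltages and walks in derived multigraphs.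

module _ (X : Multigraph) (sec : SectionOf-π X) where

  open Multigraph X
  open SectionOf-π sec

  -- γ is constant on orbits, so it fixes its own image. The membership proof is irrelevant;
  -- decidable equality of edges recovers a usable equation from it.
  value∈Image : (s : Image X sec) → Func.to γ (value s) ≡ value s
  value∈Image (s Refinement., [ p ]) = recompute (Func.to γ s ≟ᴱ s) (lemma p)
    where
    lemma : (∃[ e ] Func.to γ e ≡ s) → Func.to γ s ≡ s
    lemma (e , refl) = Func.cong γ (section e)

  module _ (G : FiniteAbelianGroup) (β : Image X sec → FiniteAbelianGroup.Carrier G) where

    open FiniteAbelianGroup G
    private
      module D = Multigraph (derived X sec G β)

    extend-value : ∀ s → extend X sec G β (value s) ≡ β s
    extend-value s with Func.to γ (value s) ≟ᴱ value s
    ... | yes p = cong β (Refinement.value-injective p)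
    ... | no ¬p = contradiction (value∈Image s) ¬p

    -- Zero is its own negative, so the orientation in which `e` is traversed does not matter.
    extend-𝟘 : ∀ e → β (representative X sec G e) ≡ 𝟘 → extend X sec G β e ≡ 𝟘
    extend-𝟘 e p with Func.to γ e ≟ᴱ e
    ... | yes _ = p
    ... | no  _ = trans (cong ⊖_ p) (ε⁻¹≈ε (AbelianGroup.group abelianGroup))

    lift : ∀ {u v} (w : Walk u v) → All (λ e → extend X sec G β e ≡ 𝟘) (edges w) →
           ∀ σ → D.Walk (u , σ) (v , σ)
    lift ε                _        σ = ε
    lift ((e , refl) ◅ w) (p ∷ ps) σ =
      ((e , σ) , cong (λ τ → (o e , σ) , (t e , τ)) (trans (cong (σ ⊕_) p) (identityʳ σ)))
        ◅ lift w ps σ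

    -- Equality in `G` is decidable, so the walk can be searched for its first edge with nonzero
    -- voltage. The disjunction supplies an explicit edge, where arguing by contradiction would not.
    constant-or-nonzero : ∀ {u v σ τ} → D.Walk (u , σ) (v , τ) →
                          σ ≡ τ ⊎ ∃[ e ] extend X sec G β e ≢ 𝟘
    constant-or-nonzero ε = inj₁ refl
    constant-or-nonzero (((e , σ) , refl) ◅ w) with Finite⇒≟ finite (extend X sec G β e) 𝟘
    ... | no  p = inj₂ (e , p)
    ... | yes p with constant-or-nonzero w
    ...   | inj₂ q = inj₂ q
    ...   | inj₁ q = inj₁ (trans (sym (trans (cong (σ ⊕_) p) (identityʳ σ))) q)

theorem2p15 : (ℓ : ℕ) (pr : Prime ℓ)
    (X : Multigraph) → Connected X →
    (𝔗 : Pred (Setoid.Carrier (Multigraph.E X)) 0ℓ) → IsSpanningTree X 𝔗 →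
    (sec : SectionOf-π X) →
    (α : Image X sec → ℤ-adic pr) →
    (∀ s → s ∈ ImageOver X sec 𝔗 → _≈ₐ_ pr (α s) (0ₐ pr)) →
    (∀ n → 0 < n → Connected (derived X sec (ℤ/ℓ^ pr n) (reduce pr α n)))
    ⇔ (∃[ s ] s ∉ ImageOver X sec 𝔗 × IsUnit pr (α s))
theorem2p15 ℓ pr X _ 𝔗 tree sec α α≈0 = mk⇔ to from
  where
  open Multigraph X
  open SectionOf-π sec
  open IsSpanningTree tree
  open ℤ-adic

  D : ℕ → Multigraph
  D n = derived X sec (ℤ/ℓ^ pr n) (reduce pr α n)

  to : (∀ n → 0 < n → Connected (D n)) → ∃[ s ] s ∉ ImageOver X sec 𝔗 × IsUnit pr (α s)
  -- A walk at level 1 joining the coordinates 0 and 1 over one vertex; these differ because ℓ > 1,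
  -- so some edge on it has nonzero voltage.
  to conn with constant-or-nonzero X sec (ℤ/ℓ^ pr 1) (reduce pr α 1)
                 (proj₂ (conn 1 z<s) (proj₁ connected , residue (0ₐ pr) 1)
                                     (proj₁ connected , residue (1ₐ pr) 1))
  ... | inj₁ 0≡1 = contradiction 0≡1 (0≢1-mod-ℓ¹ pr)
  -- Nonvanishing modulo ℓ serves twice: it keeps `s` out of the tree, where α is zero, and it makes
  -- `α s` a unit.
  ... | inj₂ (e , p) = s , (λ s∈𝔗 → αs≢0 (α≈0 s s∈𝔗 1)) , residue₁≢0⇒isUnit pr (α s) αs≢0
    where
    s : Image X sec
    s = representative X sec (ℤ/ℓ^ pr 1) e
    αs≢0 : residue (α s) 1 ≢ residue (0ₐ pr) 1
    αs≢0 q = p (extend-𝟘 X sec (ℤ/ℓ^ pr 1) (reduce pr α 1) e q)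

  from : (∃[ s ] s ∉ ImageOver X sec 𝔗 × IsUnit pr (α s)) → ∀ n → 0 < n → Connected (D n)
  from (s , _ , y , y*αs≈1 , _) n _ = (proj₁ connected , residue (0ₐ pr) n) , walk
    where
    instance
      ℓⁿ≢0 : NonZero (ℓ ^ n)
      ℓⁿ≢0 = ^-nonZero pr n

    open Multigraph (D n) using () renaming (V to Vₙ; Walk to Walkₙ)

    G : FiniteAbelianGroup
    G = ℤ/ℓ^ pr n

    β : Image X sec → Fin (ℓ ^ n)
    β = reduce pr α n

    a : ℕ
    a = toℕ (β s)

    tree-edge-𝟘 : ∀ {e} → 𝔗 e → extend X sec G β e ≡ 0 mod (ℓ ^ n)
    tree-edge-𝟘 {e} e∈𝔗 = extend-𝟘 X sec G β e
      -- Tree membership passes from `e` to the orientation of it chosen by γ, on which α is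
      -- defined.
      (α≈0 (representative X sec G e) (respects (Setoid.sym E (section e)) e∈𝔗) n)

    tree-walk : ∀ u v σ → Walkₙ (u , σ) (v , σ)
    tree-walk u v =
      let w , w⊆𝔗 = proj₂ connected u v in lift X sec G β w (All.map tree-edge-𝟘 w⊆𝔗)

    -- Each round goes through the tree to the origin of `s` without changing the coordinate, then
    -- crosses `s`, which adds `a`; a last tree walk ends at `v`. Keeping `j` a natural number lets
    -- the multiples of `a` accumulate before reduction.
    steps : ∀ k j u v → Walkₙ (u , j mod (ℓ ^ n)) (v , (j + k * a) mod (ℓ ^ n))
    steps zero    j u v =
      subst (λ i → Walkₙ (u , j mod (ℓ ^ n)) (v , i mod (ℓ ^ n)))
            (sym (+-identityʳ j)) (tree-walk u v _)
    steps (suc k) j u v =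
      tree-walk u (o (value s)) _
        ◅◅ (((value s , j mod (ℓ ^ n)) , cong (λ τ → _ , (t (value s) , τ)) shift)
          ◅ subst (λ i → Walkₙ (t (value s) , (j + a) mod (ℓ ^ n)) (v , i mod (ℓ ^ n)))
                  (+-assoc j a (k * a)) (steps k (j + a) (t (value s)) v))
      where
      shift : addMod (ℓ ^ n) (j mod (ℓ ^ n)) (extend X sec G β (value s)) ≡ (j + a) mod (ℓ ^ n)
      shift = trans (cong (addMod (ℓ ^ n) _) (extend-value X sec G β s)) (addMod-mod-+ (ℓ ^ n) j (β s))

    walk : ∀ (p q : Vₙ) → Walkₙ p q
    walk (u , σ) (v , τ) =
      -- The inverse `y` of `α s`, read modulo ℓⁿ, inverts `a`; hence some number `k` of crossings
      -- of `s` carries σ to τ.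
      let k , p = invertible⇒generates (ℓ ^ n) {a} {toℕ (residue y n)}
                    (mod≡⇒%≡ (ℓ ^ n) (y*αs≈1 n)) σ τ
      in subst₂ (λ i j → Walkₙ (u , i) (v , j)) (toℕ-mod-id σ)
                (trans (mod-cong p) (toℕ-mod-id τ)) (steps k (toℕ σ) u v)
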